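{- Let $\varphi$ be an $\mathrm{LTL}_{\mathcal T}$ specification and let $\varphi_{\mathbb B}$ be its Boolean abstraction, with Boolean environment variables $e$ and Boolean system variables $s$. If there is some unrolling depth $k\ge1$ such that the quantified Boolean formula $$\exists e^0,e^1,\dots,e^{k-1}.\ \forall s^0,s^1,\dots,s^{k-1}.\ \neg[\varphi_{\mathbb B}]^{0,k}$$ is satisfiable (i.e. true), then $\varphi_{\mathbb B}$ is unrealizable.
   Context: Fix a first-order theory $\mathcal T$ interpreted in its intended structure, a finite tuple $x$ of environment variables and a finite tuple $y$ of system variables. $\mathrm{LTL}_{\mathcal T}$ formulae are LTL formulae (Booleans, next $\bigcirc$, until $\mathcal U$, derived operators such as always $\square$ and release $\mathcal R$) whose atoms are literals $l(x,y)$ of $\mathcal T$ over the variables of the current instant. Boolean abstraction: let $l_1,\dots,l_n$ be the literals (atoms) of $\varphi$ and $s=(s_1,\dots,s_n)$ fresh Boolean system variables. A choice is a set $c\subseteq\{1,\dots,n\}$; write $c(x,y)=\bigwedge_{i\in c}l_i\wedge\bigwedge_{i\notin c}\neg l_i$ and $c^s=\bigwedge_{i\in c}s_i\wedge\bigwedge_{i\notin c}\neg s_i$. A reaction is a set $R$ of choices, with $r_R(x)=\bigwedge_{c\in R}\exists y\,c(x,y)\wedge\bigwedge_{c\notin R}\neg\exists y\,c(x,y)$; $R$ is valid if $\exists x\,r_R(x)$ holds in $\mathcal T$. Let $R_1,\dots,R_m$ be the valid reactions and $e=(e_1,\dots,e_m)$ fresh Boolean environment variables. Then $\varphi_{\mathbb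 B}=\varphi[l_i\leftarrow s_i]\wedge\square\big(\text{exactly one of }e_1,\dots,e_m\text{ is true}\rightarrow\bigwedge_{j=1}^m(e_j\rightarrow\bigvee_{c\in R_j}c^s)\big)$, an LTL formula. Realizability of $\varphi_{\mathbb B}$: in each turn $i=0,1,2,\dots$ the environment picks a Boolean valuation $e^i$ of $e$, then the system picks a Boolean valuation $s^i$ of $s$. A system strategy determines $s^i$ from $e^0,\dots,e^i$; it is winning if every resulting infinite trace satisfies $\varphi_{\mathbb B}$. $\varphi_{\mathbb B}$ is unrealizable if the system has no winning strategy. Unrolling: put the formula in negation normal form (negations only on atoms; operators $\wedge,\vee,\bigcirc,\mathcal U,\mathcal R$, with $\square\psi=\bot\,\mathcal R\,\psi$). For $k\ge1$ and copies $e^0,\dots,e^{k-1},s^0,\dots,s^{k-1}$ of the variables define $[\psi]^{i,k}$ by: $[\psi]^{i,k}=\top$ if $i\ge k$; and for $i<k$, a (possibly negated) atom is replaced by its copy at instant $i$; $[\cdot]^{i,k}$ commutes with $\wedge,\vee$ and the constants; $[\bigcirc\psi]^{i,k}=[\psi]^{i+1,k}$; $[\psi_1\,\mathcal U\,\psi_2]^{i,k}=[\psi_2]^{i,k}\vee([\psi_1]^{i,k}\wedge[\psi_1\,\mathcal U\,\psi_2]^{i+1,k})$; $[\psi_1\,\mathcal R\,\psi_2]^{i,k}=[\psi_2]^{i,k}\wedge([\psi_1]^{i,k}\vee[\psi_1\,\mathcal R\,\psi_2]^{i+1,k})$. -}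

module Defs where

open import Level using (Level; _⊔_) renaming (suc to lsuc)
open import Data.Bool.Base as Bool using (Bool; true; false; if_then_else_)
open import Data.Fin.Base using (Fin; toℕ; fromℕ<)
open import Data.Fin.Properties using () renaming (_≟_ to _≟ᶠ_)
open import Data.Fin.Subset as Subset using (Subset; inside; outside)
open import Data.List.Base as List using (List; []; _∷_; _++_; foldr; allFin; filter; filterᵇ; length)
open import Data.List.Membership.Propositional using (_∈_)
open import Data.List.Membership.Propositional.Properties using (∈-++⁺ˡ; ∈-++⁺ʳ)
open import Data.List.Relation.Unary.Any as Any using (here)
open import Data.List.Relation.Unary.Unique.Propositional using (Unique)
open import Data.Nat.Base using (ℕ; zero; suc; _+_; _≤_; _<_)
open import Data.Nat.Properties using (m<m+n; 0<1+n; +-suc; ≤-trans; ≤-reflexive)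
open import Data.Product.Base using (_×_; _,_; ∃; ∃-syntax; Σ-syntax)
open import Data.Sum.Base using (_⊎_; inj₁; inj₂; [_,_])
open import Data.Unit.Base using (⊤)
open import Data.Vec.Base as Vec using (Vec; []; _∷_; lookup; tabulate)
open import Function.Base using (_∘_)
open import Function.Bundles using (_⇔_; module Equivalence)
open import Relation.Binary.PropositionalEquality using (_≡_; _≗_; refl; sym; trans)
open import Relation.Nullary using (¬_)
open import Relation.Nullary.Decidable using (¬?)

private
  variable
    a f r d ℓ : Level
    A B : Set a

------------------------------------------------------------------------
-- First-order theories

record Signature f r : Set (lsuc (f ⊔ r)) where
  field
    Func : ℕ → Set f
    Rel  : ℕ → Set r

data Term (S : Signature f r) (V : Set) : Set f where
  var : V → Term S V
  app : ∀ {n} → Signature.Func S n → Vec (Term S V) n → Term S V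

data Atom (S : Signature f r) (V : Set) : Set (f ⊔ r) where
  rel : ∀ {n} → Signature.Rel S n → Vec (Term S V) n → Atom S V
  _≐_ : Term S V → Term S V → Atom S V

data Literal (S : Signature f r) (V : Set) : Set (f ⊔ r) where
  pos neg : Atom S V → Literal S V

-- Only truth in the intended structure matters, so a theory is its signature
-- together with that structure.
record Theory f r d ℓ : Set (lsuc (f ⊔ r ⊔ d ⊔ ℓ)) where
  field
    signature : Signature f r
  open Signature signature public
  field
    Carrier   : Set d
    inhabited : Carrier
    ⟦_⟧ᶠ      : ∀ {n} → Func n → Vec Carrier n → Carrier
    ⟦_⟧ʳ      : ∀ {n} → Rel n → Vec Carrier n → Set ℓ

module _ (𝒯 : Theory f r d ℓ) {V : Set} where
  open Theory 𝒯

  mutual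
    evalTerm : (V → Carrier) → Term signature V → Carrier
    evalTerm ρ (var v)    = ρ v
    evalTerm ρ (app g ts) = ⟦ g ⟧ᶠ (evalTerms ρ ts)

    evalTerms : ∀ {n} → (V → Carrier) → Vec (Term signature V) n → Vec Carrier n
    evalTerms ρ []       = []
    evalTerms ρ (t ∷ ts) = evalTerm ρ t ∷ evalTerms ρ ts

  AtomHolds : (V → Carrier) → Atom signature V → Set (d ⊔ ℓ)
  AtomHolds ρ (rel P ts) = Level.Lift d (⟦ P ⟧ʳ (evalTerms ρ ts))
  AtomHolds ρ (s ≐ t)    = Level.Lift ℓ (evalTerm ρ s ≡ evalTerm ρ t)

  LiteralHolds : (V → Carrier) → Literal signature V → Set (d ⊔ ℓ)
  LiteralHolds ρ (pos α) = AtomHolds ρ α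
  LiteralHolds ρ (neg α) = ¬ AtomHolds ρ α

------------------------------------------------------------------------
-- Linear temporal logic over an arbitrary set of atoms

infix  9 ¬ᴸ_ ○ᴸ_ □ᴸ_
infixr 7 _∧ᴸ_
infixr 6 _∨ᴸ_
infixr 5 _⇒ᴸ_
infixr 8 _𝒰ᴸ_ _ℛᴸ_

data LTL (A : Set a) : Set a where
  ⊤ᴸ    : LTL A
  atom  : A → LTL A
  ¬ᴸ_   : LTL A → LTL A
  _∧ᴸ_  : LTL A → LTL A → LTL A
  ○ᴸ_   : LTL A → LTL A
  _𝒰ᴸ_  : LTL A → LTL A → LTL A

⊥ᴸ : LTL A
⊥ᴸ = ¬ᴸ ⊤ᴸ

_∨ᴸ_ _⇒ᴸ_ _ℛᴸ_ : LTL A → LTL A → LTL A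
φ ∨ᴸ ψ = ¬ᴸ (¬ᴸ φ ∧ᴸ ¬ᴸ ψ)
φ ⇒ᴸ ψ = ¬ᴸ φ ∨ᴸ ψ
φ ℛᴸ ψ = ¬ᴸ (¬ᴸ φ 𝒰ᴸ ¬ᴸ ψ)

□ᴸ_ : LTL A → LTL A
□ᴸ φ = ⊥ᴸ ℛᴸ φ

⋀ᴸ ⋁ᴸ : List (LTL A) → LTL A
⋀ᴸ = foldr _∧ᴸ_ ⊤ᴸ
⋁ᴸ = foldr _∨ᴸ_ ⊥ᴸ

infix 4 _,_⊨_

_,_⊨_ : (ℕ → A → Bool) → ℕ → LTL A → Set
w , i ⊨ ⊤ᴸ       = ⊤
w , i ⊨ atom v   = w i v ≡ true
w , i ⊨ ¬ᴸ φ     = ¬ (w , i ⊨ φ)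
w , i ⊨ φ ∧ᴸ ψ   = (w , i ⊨ φ) × (w , i ⊨ ψ)
w , i ⊨ ○ᴸ φ     = w , suc i ⊨ φ
w , i ⊨ φ 𝒰ᴸ ψ   =
  ∃[ j ] (i ≤ j × (w , j ⊨ ψ) × (∀ l → i ≤ l → l < j → w , l ⊨ φ))

atoms : LTL A → List A
atoms ⊤ᴸ       = []
atoms (atom v) = v ∷ []
atoms (¬ᴸ φ)   = atoms φ
atoms (φ ∧ᴸ ψ) = atoms φ ++ atoms ψ
atoms (○ᴸ φ)   = atoms φ
atoms (φ 𝒰ᴸ ψ) = atoms φ ++ atoms ψ

-- Replaces each atom, given that it occurs in the formula.
mapAtoms : (φ : LTL A) → (∀ {v} → v ∈ atoms φ → B) → LTL B
mapAtoms ⊤ᴸ       g = ⊤ᴸ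
mapAtoms (atom v) g = atom (g (here refl))
mapAtoms (¬ᴸ φ)   g = ¬ᴸ mapAtoms φ g
mapAtoms (φ ∧ᴸ ψ) g =
  mapAtoms φ (λ p → g (∈-++⁺ˡ p)) ∧ᴸ mapAtoms ψ (λ p → g (∈-++⁺ʳ (atoms φ) p))
mapAtoms (○ᴸ φ)   g = ○ᴸ mapAtoms φ g
mapAtoms (φ 𝒰ᴸ ψ) g =
  mapAtoms φ (λ p → g (∈-++⁺ˡ p)) 𝒰ᴸ mapAtoms ψ (λ p → g (∈-++⁺ʳ (atoms φ) p))

------------------------------------------------------------------------
-- LTL modulo a theory, with p environment and q system variables

TVar : ℕ → ℕ → Set
TVar p q = Fin p ⊎ Fin q

LTL-T : Theory f r d ℓ → ℕ → ℕ → Set (f ⊔ r)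
LTL-T 𝒯 p q = LTL (Literal (Theory.signature 𝒯) (TVar p q))

-- The list l₁, …, lₙ of the distinct literals of φ. It is data because
-- removing duplicates would need decidable equality of symbols.
record LiteralsOf {L : Set a} (φ : LTL L) : Set a where
  field
    literals : List L
    distinct : Unique literals
    exact    : ∀ {l} → l ∈ literals ⇔ l ∈ atoms φ

  n : ℕ
  n = length literals

  lit : Fin n → L
  lit = List.lookup literals

  indexOf : ∀ {l} → l ∈ atoms φ → Fin n
  indexOf = Any.index ∘ Equivalence.from exact

------------------------------------------------------------------------
-- Choices and reactions

Choice : ℕ → Set
Choice = Subset

-- A set of choices, given by its indicator function.
Reaction : ℕ → Set
Reaction n = Choice n → Bool

choices : ∀ n → List (Choice n)
choices zero    = [] ∷ []
choices (suc n) =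
  List.map (outside ∷_) (choices n) ++ List.map (inside ∷_) (choices n)

module _ (𝒯 : Theory f r d ℓ) {p q : ℕ} {φ : LTL-T 𝒯 p q} (Ls : LiteralsOf φ) where
  open Theory 𝒯
  open LiteralsOf Ls

  ChoiceHolds : Choice n → Vec Carrier p → Vec Carrier q → Set (d ⊔ ℓ)
  ChoiceHolds c x y =
      (∀ i → i Subset.∈ c → LiteralHolds 𝒯 ρ (lit i))
    × (∀ i → i Subset.∉ c → ¬ LiteralHolds 𝒯 ρ (lit i))
    where
    ρ : TVar p q → Carrier
    ρ = [ lookup x , lookup y ]

  ReactionHolds : Reaction n → Vec Carrier p → Set (d ⊔ ℓ)
  ReactionHolds R x =
      (∀ c → R c ≡ true → ∃[ y ] ChoiceHolds c x y)
    × (∀ c → R c ≡ false → ¬ (∃[ y ] ChoiceHolds c x y))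

  Valid : Reaction n → Set (d ⊔ ℓ)
  Valid R = ∃[ x ] ReactionHolds R x

  -- The valid reactions R₁, …, Rₘ without repetition. This is data because
  -- validity need not be decidable.
  record ValidReactions : Set (d ⊔ ℓ) where
    field
      m        : ℕ
      R        : Fin m → Reaction n
      valid    : ∀ j → Valid (R j)
      complete : ∀ R′ → Valid R′ → ∃[ j ] R j ≗ R′
      distinct : ∀ {i j} → R i ≗ R j → i ≡ j

------------------------------------------------------------------------
-- Boolean abstraction

data BVar (m n : ℕ) : Set where
  env : Fin m → BVar m n
  sys : Fin n → BVar m n

exactlyOneEnv : ∀ {m n} → LTL (BVar m n)
exactlyOneEnv {m} = ⋁ᴸ (List.map only (allFin m))
  where
  only : Fin m → LTL (BVar m _)
  only j = atom (env j) ∧ᴸ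
           ⋀ᴸ (List.map (λ i → ¬ᴸ atom (env i)) (filter (λ i → ¬? (i ≟ᶠ j)) (allFin m)))

choiceFormula : ∀ {m n} → Choice n → LTL (BVar m n)
choiceFormula {n = n} c =
  ⋀ᴸ (List.map (λ i → if lookup c i then atom (sys i) else ¬ᴸ atom (sys i)) (allFin n))

module _ (𝒯 : Theory f r d ℓ) {p q : ℕ} (φ : LTL-T 𝒯 p q)
         (Ls : LiteralsOf φ) (Rs : ValidReactions 𝒯 Ls) where
  open LiteralsOf Ls using (n; indexOf)
  open ValidReactions Rs using (m; R)

  reactionFormula : Fin m → LTL (BVar m n)
  reactionFormula j = ⋁ᴸ (List.map choiceFormula (filterᵇ (R j) (choices n)))

  booleanAbstraction : LTL (BVar m n)
  booleanAbstraction =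
    mapAtoms φ (λ l∈φ → sys (indexOf l∈φ)) ∧ᴸ
    □ᴸ (exactlyOneEnv ⇒ᴸ
        ⋀ᴸ (List.map (λ j → atom (env j) ⇒ᴸ reactionFormula j) (allFin m)))

------------------------------------------------------------------------
-- Realizability

EnvVal SysVal : ℕ → Set
EnvVal = Vec Bool
SysVal = Vec Bool

valuation : ∀ {m n} → EnvVal m → SysVal n → BVar m n → Bool
valuation e s (env j) = lookup e j
valuation e s (sys i) = lookup s i

-- The i-th system move depends on the environment moves at 0, …, i.
Strategy : ℕ → ℕ → Set
Strategy m n = ∀ i → Vec (EnvVal m) (suc i) → SysVal n

play : ∀ {m n} → Strategy m n → (ℕ → EnvVal m) → ℕ → BVar m n → Bool
play σ e i = valuation (e i) (σ i (tabulate (e ∘ toℕ)))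

Winning : ∀ {m n} → LTL (BVar m n) → Strategy m n → Set
Winning φ σ = ∀ e → play σ e , 0 ⊨ φ

Realizable Unrealizable : ∀ {m n} → LTL (BVar m n) → Set
Realizable {m} {n} φ = Σ[ σ ∈ Strategy m n ] Winning φ σ
Unrealizable φ = ¬ Realizable φ

------------------------------------------------------------------------
-- Negation normal form

infixr 7 _∧ᴺ_
infixr 6 _∨ᴺ_
infixr 8 _𝒰ᴺ_ _ℛᴺ_
infix  9 ○ᴺ_

data NNF (A : Set a) : Set a where
  ⊤ᴺ ⊥ᴺ                   : NNF A
  posᴺ negᴺ               : A → NNF A
  _∧ᴺ_ _∨ᴺ_ _𝒰ᴺ_ _ℛᴺ_     : NNF A → NNF A → NNF A
  ○ᴺ_                     : NNF A → NNF A

-- nnf¬ φ is the negation normal form of ¬ φ.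
mutual
  nnf : LTL A → NNF A
  nnf ⊤ᴸ       = ⊤ᴺ
  nnf (atom v) = posᴺ v
  nnf (¬ᴸ φ)   = nnf¬ φ
  nnf (φ ∧ᴸ ψ) = nnf φ ∧ᴺ nnf ψ
  nnf (○ᴸ φ)   = ○ᴺ nnf φ
  nnf (φ 𝒰ᴸ ψ) = nnf φ 𝒰ᴺ nnf ψ

  nnf¬ : LTL A → NNF A
  nnf¬ ⊤ᴸ       = ⊥ᴺ
  nnf¬ (atom v) = negᴺ v
  nnf¬ (¬ᴸ φ)   = nnf φ
  nnf¬ (φ ∧ᴸ ψ) = nnf¬ φ ∨ᴺ nnf¬ ψ
  nnf¬ (○ᴸ φ)   = ○ᴺ nnf¬ φ
  nnf¬ (φ 𝒰ᴸ ψ) = nnf¬ φ ℛᴺ nnf¬ ψ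

------------------------------------------------------------------------
-- Propositional formulae and unrolling

infix  9 ¬ᴾ_
infixr 7 _∧ᴾ_
infixr 6 _∨ᴾ_

data PropFormula (A : Set a) : Set a where
  ⊤ᴾ ⊥ᴾ     : PropFormula A
  varᴾ      : A → PropFormula A
  ¬ᴾ_       : PropFormula A → PropFormula A
  _∧ᴾ_ _∨ᴾ_ : PropFormula A → PropFormula A → PropFormula A

evalᴾ : (A → Bool) → PropFormula A → Bool
evalᴾ v ⊤ᴾ       = true
evalᴾ v ⊥ᴾ       = false
evalᴾ v (varᴾ x) = v x
evalᴾ v (¬ᴾ φ)   = Bool.not (evalᴾ v φ)
evalᴾ v (φ ∧ᴾ ψ) = evalᴾ v φ Bool.∧ evalᴾ v ψ
evalᴾ v (φ ∨ᴾ ψ) = evalᴾ v φ Bool.∨ evalᴾ v ψ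

instant : ∀ {k} i t → .(i + suc t ≡ k) → Fin k
instant i t i+1+t≡k =
  fromℕ< {i} (≤-trans (m<m+n i 0<1+n) (≤-reflexive i+1+t≡k))

-- [ψ]^{i,k}, by recursion on the number t = k - i of remaining instants;
-- the case i ≥ k is t = 0. The variable (j , v) is the copy of v at instant j.
unroll : ∀ {k} i t → .(i + t ≡ k) → NNF A → PropFormula (Fin k × A)
unroll i zero    eq ψ          = ⊤ᴾ
unroll i (suc t) eq ⊤ᴺ         = ⊤ᴾ
unroll i (suc t) eq ⊥ᴺ         = ⊥ᴾ
unroll i (suc t) eq (posᴺ v)   = varᴾ (instant i t eq , v)
unroll i (suc t) eq (negᴺ v)   = ¬ᴾ varᴾ (instant i t eq , v)
unroll i (suc t) eq (φ ∧ᴺ ψ)   = unroll i (suc t) eq φ ∧ᴾ unroll i (suc t) eq ψ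
unroll i (suc t) eq (φ ∨ᴺ ψ)   = unroll i (suc t) eq φ ∨ᴾ unroll i (suc t) eq ψ
unroll i (suc t) eq (○ᴺ ψ)     = unroll (suc i) t (trans (sym (+-suc i t)) eq) ψ
unroll i (suc t) eq (φ 𝒰ᴺ ψ)   =
  unroll i (suc t) eq ψ ∨ᴾ
  (unroll i (suc t) eq φ ∧ᴾ unroll (suc i) t (trans (sym (+-suc i t)) eq) (φ 𝒰ᴺ ψ))
unroll i (suc t) eq (φ ℛᴺ ψ)   =
  unroll i (suc t) eq ψ ∧ᴾ
  (unroll i (suc t) eq φ ∨ᴾ unroll (suc i) t (trans (sym (+-suc i t)) eq) (φ ℛᴺ ψ))

[_]^⟨0,_⟩ : LTL A → ∀ k → PropFormula (Fin k × A)
[ φ ]^⟨0, k ⟩ = unroll 0 k refl (nnf φ)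

copies : ∀ {m n k} → Vec (EnvVal m) k → Vec (SysVal n) k → Fin k × BVar m n → Bool
copies es ss (i , v) = valuation (lookup es i) (lookup ss i) v

-- Truth of ∃ e⁰ … eᵏ⁻¹. ∀ s⁰ … sᵏ⁻¹. Φ.
QBF-∃∀-True : ∀ {m n} k → PropFormula (Fin k × BVar m n) → Set
QBF-∃∀-True {m} {n} k Φ =
  Σ[ es ∈ Vec (EnvVal m) k ] (∀ (ss : Vec (SysVal n) k) → evalᴾ (copies es ss) Φ ≡ true)

{-# OPTIONS --safe #-}
-- A trace that satisfies a formula also satisfies each of its unrollings, since
-- cutting the future off at k only replaces obligations by ⊤. So if fixed
-- environment moves e⁰, …, eᵏ⁻¹ falsify the unrolling for all system moves, the
-- environment defeats every strategy by playing them.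
module Submission where

open import Defs
open import Data.Bool.Base using (Bool; true; false; not; _∧_; _∨_)
open import Data.Bool.Properties using (not-¬)
open import Data.Fin.Base using (Fin; zero; suc; toℕ)
open import Data.Fin.Properties using (toℕ-fromℕ<)
open import Data.Nat.Base using (ℕ; zero; suc; _+_; _≤_; _<_)
open import Data.Nat.Properties
  using (≤-refl; <⇒≤; <-≤-trans; n≮n; m≤n⇒m<n∨m≡n)
open import Data.Product.Base using (_×_; _,_; ∃-syntax)
open import Data.Sum.Base using (_⊎_; inj₁; inj₂)
open import Data.Unit.Base using (tt)
open import Data.Vec.Base using (Vec; []; _∷_; lookup; tabulate; replicate)
open import Data.Vec.Properties using (lookup∘tabulate)
open import Function.Base using (_∘_)
open import Relation.Binary.PropositionalEquality
  using (_≡_; refl; sym; trans; cong; cong₂)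
open import Relation.Nullary using (¬_; contradiction)

module _ {a} {A : Set a} {w : ℕ → A → Bool} where

  𝒰-now : ∀ {φ ψ i} → w , i ⊨ ψ → w , i ⊨ φ 𝒰ᴸ ψ
  𝒰-now {i = i} ψᵢ = i , ≤-refl , ψᵢ , λ l i≤l l<i → contradiction (<-≤-trans l<i i≤l) (n≮n l)

  𝒰-later : ∀ {φ ψ i} → w , i ⊨ φ → w , suc i ⊨ φ 𝒰ᴸ ψ → w , i ⊨ φ 𝒰ᴸ ψ
  𝒰-later {φ} {i = i} φᵢ (j , i<j , ψⱼ , φ-until) = j , <⇒≤ i<j , ψⱼ , φ-from-i
    where
    φ-from-i : ∀ l → i ≤ l → l < j → w , l ⊨ φ
    φ-from-i l i≤l l<j with m≤n⇒m<n∨m≡n i≤l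
    ... | inj₁ i<l  = φ-until l i<l l<j
    ... | inj₂ refl = φᵢ

  𝒰-unfold : ∀ {φ ψ i} → w , i ⊨ φ 𝒰ᴸ ψ →
             (w , i ⊨ ψ) ⊎ ((w , i ⊨ φ) × (w , suc i ⊨ φ 𝒰ᴸ ψ))
  𝒰-unfold {i = i} (j , i≤j , ψⱼ , φ-until) with m≤n⇒m<n∨m≡n i≤j
  ... | inj₂ refl = inj₁ ψⱼ
  ... | inj₁ i<j  =
    inj₂ (φ-until i ≤-refl i<j , j , i<j , ψⱼ , λ l i<l → φ-until l (<⇒≤ i<l))

-- Satisfaction on a trace is undecidable, so a disjunction is proved by splitting on the Boolean
-- value of its first disjunct instead.
∨-fromFalse : ∀ x {y} → (x ≡ false → y ≡ true) → x ∨ y ≡ true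
∨-fromFalse true  _ = refl
∨-fromFalse false h = h refl

¬¬true⇒true : ∀ {x} → ¬ ¬ (x ≡ true) → x ≡ true
¬¬true⇒true {true}  _ = refl
¬¬true⇒true {false} h = contradiction (λ ()) h

¬true⇒not≡true : ∀ {x} → ¬ (x ≡ true) → not x ≡ true
¬true⇒not≡true {true}  h = contradiction refl h
¬true⇒not≡true {false} _ = refl

false⇒refuted : ∀ {p} {P : Set p} {x} → (P → x ≡ true) → x ≡ false → ¬ P
false⇒refuted h refl p with () ← h p

-- Constructively, φ ⊨ does not imply its negation normal form on a trace, but
-- evaluation is Boolean, so it suffices to assume satisfaction up to ¬¬.
module _ {a} {A : Set a} {k} {w : ℕ → A → Bool} {v : Fin k × A → Bool}
         (agree : ∀ j x → v (j , x) ≡ w (toℕ j) x) where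

  agree-instant : ∀ i t .(eq : i + suc t ≡ k) x → v (instant i t eq , x) ≡ w i x
  agree-instant i t eq x =
    trans (agree (instant i t eq) x) (cong (λ j → w j x) (toℕ-fromℕ< _))

  mutual
    -- Induction on `t`, then on `φ`: the expansion of an until recurs on the same formula, but with
    -- one instant fewer remaining.
    unroll-nnf : ∀ φ i t .(eq : i + t ≡ k) → ¬ ¬ (w , i ⊨ φ) →
                 evalᴾ v (unroll i t eq (nnf φ)) ≡ true
    unroll-nnf φ        i zero    eq h = refl
    unroll-nnf ⊤ᴸ       i (suc t) eq h = refl
    unroll-nnf (atom x) i (suc t) eq h =
      trans (agree-instant i t eq x) (¬¬true⇒true h)
    unroll-nnf (¬ᴸ φ)   i (suc t) eq h =
      unroll-nnf¬ φ i (suc t) eq λ φᵢ → h λ ¬φᵢ → ¬φᵢ φᵢ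
    unroll-nnf (φ ∧ᴸ ψ) i (suc t) eq h = cong₂ _∧_
      (unroll-nnf φ i (suc t) eq λ ¬φᵢ → h λ (φᵢ , _) → ¬φᵢ φᵢ)
      (unroll-nnf ψ i (suc t) eq λ ¬ψᵢ → h λ (_ , ψᵢ) → ¬ψᵢ ψᵢ)
    unroll-nnf (○ᴸ φ)   i (suc t) eq h = unroll-nnf φ (suc i) t _ h
    unroll-nnf (φ 𝒰ᴸ ψ) i (suc t) eq h = ∨-fromFalse _ λ ψ-false →
      let ¬¬later : ¬ ¬ ((w , i ⊨ φ) × (w , suc i ⊨ φ 𝒰ᴸ ψ))
          ¬¬later ¬later = h λ u → case-𝒰 ψ-false ¬later (𝒰-unfold {φ = φ} {ψ} u)
      in cong₂ _∧_
        (unroll-nnf φ i (suc t) eq λ ¬φᵢ → ¬¬later λ (φᵢ , _) → ¬φᵢ φᵢ)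
        (unroll-nnf (φ 𝒰ᴸ ψ) (suc i) t _ λ ¬u → ¬¬later λ (_ , u) → ¬u u)
      where
      case-𝒰 : evalᴾ v (unroll i (suc t) eq (nnf ψ)) ≡ false →
               ∀ {P : Set} → ¬ P → ¬ ((w , i ⊨ ψ) ⊎ P)
      case-𝒰 _       ¬p (inj₂ p)  = ¬p p
      case-𝒰 ψ-false ¬p (inj₁ ψᵢ) =
        false⇒refuted (unroll-nnf ψ i (suc t) eq) ψ-false λ ¬ψᵢ → ¬ψᵢ ψᵢ

    -- This does not follow from `unroll-nnf` by Boolean negation: at the cut both `nnf φ` and
    -- `nnf¬ φ` unroll to `⊤ᴾ`. Hence both polarities are carried through a mutual induction.
    unroll-nnf¬ : ∀ φ i t .(eq : i + t ≡ k) → ¬ (w , i ⊨ φ) →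
                  evalᴾ v (unroll i t eq (nnf¬ φ)) ≡ true
    unroll-nnf¬ φ        i zero    eq h = refl
    unroll-nnf¬ ⊤ᴸ       i (suc t) eq h = contradiction tt h
    unroll-nnf¬ (atom x) i (suc t) eq h =
      ¬true⇒not≡true (h ∘ trans (sym (agree-instant i t eq x)))
    unroll-nnf¬ (¬ᴸ φ)   i (suc t) eq h = unroll-nnf φ i (suc t) eq h
    unroll-nnf¬ (φ ∧ᴸ ψ) i (suc t) eq h = ∨-fromFalse _ λ ¬φ-false →
      unroll-nnf¬ ψ i (suc t) eq λ ψᵢ →
        false⇒refuted (unroll-nnf¬ φ i (suc t) eq) ¬φ-false λ φᵢ → h (φᵢ , ψᵢ)
    unroll-nnf¬ (○ᴸ φ)   i (suc t) eq h = unroll-nnf¬ φ (suc i) t _ h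
    -- Contraposing the two introduction rules of until gives the expansion of release: `ψ` fails
    -- now, and either `φ` fails now or the until fails at `suc i`.
    unroll-nnf¬ (φ 𝒰ᴸ ψ) i (suc t) eq h = cong₂ _∧_
      (unroll-nnf¬ ψ i (suc t) eq (h ∘ 𝒰-now {φ = φ} {ψ}))
      (∨-fromFalse _ λ ¬φ-false → unroll-nnf¬ (φ 𝒰ᴸ ψ) (suc i) t _ λ u →
        false⇒refuted (unroll-nnf¬ φ i (suc t) eq) ¬φ-false λ φᵢ →
          h (𝒰-later {φ = φ} {ψ} φᵢ u))

  unroll-sound : ∀ φ → w , 0 ⊨ φ → evalᴾ v [ φ ]^⟨0, k ⟩ ≡ true
  unroll-sound φ φ₀ = unroll-nnf φ 0 k refl λ ¬φ₀ → ¬φ₀ φ₀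

padWith : ∀ {a} {A : Set a} {k} → A → Vec A k → ℕ → A
padWith x []       i       = x
padWith x (y ∷ ys) zero    = y
padWith x (y ∷ ys) (suc i) = padWith x ys i

lookup≡padWith : ∀ {a} {A : Set a} {k} (x : A) (ys : Vec A k) j →
                 lookup ys j ≡ padWith x ys (toℕ j)
lookup≡padWith x (y ∷ ys) zero    = refl
lookup≡padWith x (y ∷ ys) (suc j) = lookup≡padWith x ys j

QBF-∃∀⇒Unrealizable : ∀ {m n} (φ : LTL (BVar m n)) k →
                      QBF-∃∀-True k (¬ᴾ [ φ ]^⟨0, k ⟩) → Unrealizable φ
QBF-∃∀⇒Unrealizable {m} {n} φ k (es , refutes) (σ , winning) =
  not-¬ (refutes ss) (cong not (unroll-sound agree φ (winning e)))
  where
  -- A play is infinite, so the `k` witnessing moves are padded; the padding value is arbitrary, as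
  -- the unrolling reads only instants below `k`.
  e : ℕ → EnvVal m
  e = padWith (replicate m false) es

  -- Against this fixed sequence of moves the answers of `σ` form one fixed vector, at which the
  -- universal quantifier over system moves is instantiated.
  response : Fin k → SysVal n
  response j = σ (toℕ j) (tabulate (e ∘ toℕ))

  ss : Vec (SysVal n) k
  ss = tabulate response

  agree : ∀ j x → copies es ss (j , x) ≡ play σ e (toℕ j) x
  agree j x = cong₂ (λ eⱼ sⱼ → valuation eⱼ sⱼ x)
    (lookup≡padWith _ es j) (lookup∘tabulate response j)

theorem2 : ∀ {f r d ℓ} (𝒯 : Theory f r d ℓ) (p q : ℕ) (φ : LTL-T 𝒯 p q)
    (Ls : LiteralsOf φ) (Rs : ValidReactions 𝒯 Ls) →
    ∃[ k ] (1 ≤ k × QBF-∃∀-True k (¬ᴾ [ booleanAbstraction 𝒯 φ Ls Rs ]^⟨0, k ⟩)) →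
    Unrealizable (booleanAbstraction 𝒯 φ Ls Rs)
theorem2 𝒯 p q φ Ls Rs (k , _ , qbf) =
  QBF-∃∀⇒Unrealizable (booleanAbstraction 𝒯 φ Ls Rs) k qbf
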